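{- On metric graphs the skeleton dimension and the bandwidth are incomparable, i.e. on the class of metric weighted graphs neither parameter is bounded by a function of the other.
   Context: Graphs $G=(V,E)$ are finite, simple, undirected and connected, with $n$ nodes and edge weights $\ell\colon E\to\mathbb{Q}^+$; $\mathrm{dist}_G(u,v)$ is the shortest path distance, and the shortest path between any two nodes is assumed to be unique. A weighted graph is metric if its edge weights satisfy the triangle inequality, i.e. $\ell(\{u,v\})=\mathrm{dist}_G(u,v)$ for every edge $\{u,v\}\in E$. Parameters $p,q$ are incomparable on a class of graphs if there is no function $f\colon\mathbb{N}\to\mathbb{N}$ with $p(G)\le f(q(G))$ for all $G$ in the class and no function $g\colon\mathbb{N}\to\mathbb{N}$ with $q(G)\le g(p(G))$ for all $G$ in the class. Parameters of unweighted graphs are applied to weighted graphs by ignoring the weights. Geometric realization: $\tilde G=(\tilde V,\tilde E)$ is the continuous version of $G$ in which every edge $\{u,v\}$ is replaced by a segment of length $\ell(\{u,v\})$; thus $V\subseteq\tilde V$, distances between nodes of $V$ are unchanged, and for every edge $\{u,v\}$ and $0\le\alpha\le\ell(\{u,v\})$ there is a point $w\in\tilde V$ on it with $\mathrm{dist}(u,w)=\alpha$ and $\mathrm{dist}(w,v)=\ell(\{u,v\})-\alpha$. Skeleton dimension: for $s\in V$ let $T_s$ be the shortest path tree of $s$ and $\tilde T_s$ its geometric realization. The skeleton $T_s^*$ is the subtree of $\tilde T_s$ induced by all points $v$ that have a descendant $w$ in $\tilde T_s$ (rooted at $s$) with $\mathrm{dist}(v,w)\ge\frac12\mathrm{dist}(s,v)$.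 For $r\ge 0$, $\mathrm{Cut}_s^r$ is the set of all points $u$ of $T_s^*$ with $\mathrm{dist}(s,u)=r$. The skeleton dimension of $G$ is $\kappa=\max_{s,r}|\mathrm{Cut}_s^r|$. The bandwidth of $G$ is the minimum, over all bijections $f\colon V\to\{1,\dots,n\}$, of $\max\{|f(u)-f(v)| : \{u,v\}\in E\}$. -}

module Defs where

open import Data.Nat as ℕ using (ℕ; ∣_-_∣)
open import Data.Fin using (Fin; toℕ)
open import Data.Fin.Permutation using (Permutation′; _⟨$⟩ʳ_)
open import Data.List using (List; length; map; filter; allFin; cartesianProduct)
open import Data.List.Extrema.Nat using (max)
open import Data.List.Membership.Propositional using (_∈_)
open import Data.List.Relation.Unary.Unique.Propositional using (Unique)
open import Data.Product using (Σ-syntax; ∃; ∃-syntax; ∃!; _×_; _,_; proj₁; uncurry)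
open import Data.Rational as ℚ using (ℚ; 0ℚ; ½; _+_; _-_; _*_; _≤_; _<_)
open import Function using (_⇔_)
open import Relation.Binary using (Rel; Symmetric; Decidable; Irrelevant)
open import Relation.Binary.Construct.Closure.ReflexiveTransitive using (Star; fold; ε; _◅_; _◅◅_)
open import Relation.Binary.PropositionalEquality using (_≡_)
open import Relation.Nullary using (¬_)
open import Relation.Unary using (Pred)
open import Level using (0ℓ)

-- An undirected edge {u,v} is seen from both of its ends, as an element of
-- Edge u v and of Edge v u.
record Graph : Set₁ where
  field
    n          : ℕ
  V : Set
  V = Fin n
  field
    Edge       : Rel V 0ℓ
    edge?      : Decidable Edge
    irrelevant : Irrelevant Edge
    symmetric  : Symmetric Edge
    loopless   : ∀ {v} → ¬ Edge v v

  Walk : Rel V 0ℓ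
  Walk = Star Edge

record WeightedGraph : Set₁ where
  field
    graph : Graph
  open Graph graph public
  field
    ℓ     : ∀ {u v} → Edge u v → ℚ
    ℓ-sym : ∀ {u v} (e : Edge u v) → ℓ (symmetric e) ≡ ℓ e
    ℓ-pos : ∀ {u v} (e : Edge u v) → 0ℚ < ℓ e

  weight : ∀ {u v} → Walk u v → ℚ
  weight = fold (λ _ _ → ℚ) (λ e d → ℓ e + d) 0ℚ

  -- Weights are positive, so a shortest walk repeats no node.
  Shortest : ∀ {u v} → Walk u v → Set
  Shortest {u} {v} p = (q : Walk u v) → weight p ≤ weight q

  field
    connected       : ∀ u v → Walk u v
    unique-shortest : ∀ u v → ∃! _≡_ (Shortest {u} {v})

  shortest : ∀ u v → Walk u v
  shortest u v = proj₁ (unique-shortest u v)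

  dist : V → V → ℚ
  dist u v = weight (shortest u v)

IsMetric : WeightedGraph → Set
IsMetric G = ∀ {u v} (e : Edge u v) → ℓ e ≡ dist u v
  where open WeightedGraph G

HasSize : ∀ {A : Set} → Pred A 0ℓ → ℕ → Set
HasSize {A} P k =
  Σ[ xs ∈ List A ] Unique xs × (∀ x → x ∈ xs ⇔ P x) × length xs ≡ k

IsMinimum IsMaximum : Pred ℕ 0ℓ → Pred ℕ 0ℓ
IsMinimum P m = P m × (∀ k → P k → m ℕ.≤ k)
IsMaximum P m = P m × (∀ k → P k → k ℕ.≤ m)

module _ (G : Graph) where
  open Graph G

  edges : List (V × V)
  edges = filter (uncurry edge?) (cartesianProduct (allFin n) (allFin n))

  -- 0 for a graph without edges.  Positions are numbered 0, …, n-1 instead of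
  -- 1, …, n, which does not affect differences.
  stretch : Permutation′ n → ℕ
  stretch f = max 0 (map (λ (u , v) → ∣ toℕ (f ⟨$⟩ʳ u) - toℕ (f ⟨$⟩ʳ v) ∣) edges)

  IsBandwidth : Pred ℕ 0ℓ
  IsBandwidth = IsMinimum (λ b → ∃[ f ] stretch f ≡ b)

module _ (G : WeightedGraph) where
  open WeightedGraph G

  -- inside {u} {v} e α is the point of the segment of e at distance α from u.
  -- It lies strictly between u and v when 0 < α < ℓ e.  Offsets are rational:
  -- since all weights are, the points at distance r from s on one edge of the
  -- skeleton exist for r in an interval (a , b] with a and b rational, so
  -- admitting real offsets and radii would not change the maximal cut size.
  data Point : Set where
    node   : V → Point
    inside : ∀ {u v} → Edge u v → ℚ → Point

  module _ (s : V) where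

    -- e, directed away from the root, is an edge of the shortest path tree.
    TreeEdge : ∀ {u v} → Edge u v → Set
    TreeEdge {u} {v} e = shortest s v ≡ shortest s u ◅◅ (e ◅ ε)

    -- The points of the realization of the shortest path tree.  Edges are
    -- directed away from s, so every point has exactly one representation.
    data InTree : Pred Point 0ℓ where
      node   : ∀ v → InTree (node v)
      inside : ∀ {u v α} {e : Edge u v} → TreeEdge e →
               0ℚ < α → α < ℓ e → InTree (inside e α)

    depth : Point → ℚ
    depth (node v)         = dist s v
    depth (inside {u} _ α) = dist s u + α

    -- Descends x w d: w is a descendant of x (possibly x itself), and the tree
    -- path from x down to w has length d.
    data Descends : Point → Point → ℚ → Set where
      node-node     : ∀ {v w} (p : Walk v w) → shortest s w ≡ shortest s v ◅◅ p →
                      Descends (node v) (node w) (weight p)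
      node-inside   : ∀ {v u′ v′ d β} {e′ : Edge u′ v′} →
                      Descends (node v) (node u′) d →
                      Descends (node v) (inside e′ β) (d + β)
      inside-node   : ∀ {u v w d α} {e : Edge u v} →
                      Descends (node v) (node w) d →
                      Descends (inside e α) (node w) ((ℓ e - α) + d)
      inside-inside : ∀ {u v u′ v′ d α β} {e : Edge u v} {e′ : Edge u′ v′} →
                      Descends (node v) (node u′) d →
                      Descends (inside e α) (inside e′ β) ((ℓ e - α) + d + β)
      same-edge     : ∀ {u v α β} {e : Edge u v} → α ≤ β →
                      Descends (inside e α) (inside e β) (β - α)

    InSkeleton : Pred Point 0ℓ
    InSkeleton x = InTree x ×
      (∃[ w ] ∃[ d ] InTree w × Descends x w d × ½ * depth x ≤ d)

    Cut : ℚ → Pred Point 0ℓ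
    Cut r x = InSkeleton x × depth x ≡ r

  IsSkeletonDimension : Pred ℕ 0ℓ
  IsSkeletonDimension =
    IsMaximum (λ k → ∃[ s ] ∃[ r ] 0ℚ ≤ r × HasSize (Cut s r) k)

-- A parameter is given by its graph: p G k means that p takes the value k at G.
Parameter : Set₁
Parameter = WeightedGraph → Pred ℕ 0ℓ

BoundedBy : (WeightedGraph → Set) → Parameter → Parameter → Set₁
BoundedBy C p q = Σ[ f ∈ (ℕ → ℕ) ]
  (∀ G → C G → ∀ {a b} → p G a → q G b → a ℕ.≤ f b)

Incomparable : (WeightedGraph → Set) → Parameter → Parameter → Set₁
Incomparable C p q = ¬ BoundedBy C p q × ¬ BoundedBy C q p

Bandwidth : Parameter
Bandwidth G = IsBandwidth (WeightedGraph.graph G)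

{-# OPTIONS --safe #-}
module Submission where

-- Trees are metric, and both separating families consist of trees.
--
-- The skeleton dimension is unbounded on combs, whose bandwidth is at most 2:
-- from one end of a spine of length less than 1 with legs of length 2, all legs
-- reach distance 1 and continue far enough beyond.
--
-- The bandwidth is unbounded on binary trees, as they have small diameter.  Give
-- every edge at most a third of the length of its parent edge.  Then a subtree
-- reached downwards through an edge of length l has depth less than l / 2, so the
-- skeleton of s consists of parts of edges incident to the path P from s to the
-- root.  An edge hanging off P at u is no longer than the next edge of P after u,
-- so all points at a given distance from s lie on edges at a single node of P.
--
-- The values of the two parameters are only shown to exist up to double
-- negation, which suffices because the theorem is a negative statement.

open import Data.Empty using (⊥)
open import Data.Fin as Fin using (Fin; zero; suc; toℕ)
import Data.Fin.Properties as Fin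
open import Data.Fin.Permutation using (Permutation′; _⟨$⟩ʳ_; _⟨$⟩ˡ_; inverseʳ; id)
open import Data.List using (List; []; _∷_; length; map; lookup; allFin; cartesianProduct)
open import Data.List.Extrema.Nat using (xs≤max; max≤v⁺)
open import Data.List.Membership.Propositional using (_∈_; find; lose)
open import Data.List.Membership.Propositional.Properties using (∈-lookup; ∈-map⁺; ∈-map⁻; ∈-allFin; ∈-filter⁺; ∈-filter⁻; ∈-cartesianProduct⁺)
open import Data.List.Properties using (length-map; length-tabulate)
open import Data.List.Relation.Unary.All as All using (All; []; _∷_)
import Data.List.Relation.Unary.All.Properties as All
open import Data.List.Relation.Unary.AllPairs as AllPairs using ([]; _∷_)
open import Data.List.Relation.Unary.Any as Any using (Any; here; there)
import Data.List.Relation.Unary.Any.Properties as Any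
open import Data.List.Relation.Unary.Unique.Propositional using (Unique)
import Data.List.Relation.Unary.Unique.Propositional.Properties as Unique
open import Data.Maybe using (Maybe; nothing; just)
open import Data.Maybe.Properties using (just-injective)
open import Data.Nat as ℕ using (ℕ; zero; suc)
import Data.Integer as ℤ
import Data.Nat.Properties as ℕ
import Data.Nat.Solver
open import Data.Product using (∃; ∃-syntax; _×_; _,_; proj₁; proj₂; uncurry)
open import Data.Rational as ℚ using (ℚ; 0ℚ; 1ℚ; ½; _+_; _-_; _*_; _≤_; _<_)
import Data.Rational.Properties as ℚ
open import Data.Rational.Solver using (module +-*-Solver)
open import Data.Sum using (_⊎_; inj₁; inj₂)
open import Function using (_∘_; case_of_; mk⇔; Equivalence)
open import Level using (0ℓ)
open import Relation.Binary using (DecidableEquality; tri<; tri≈; tri>)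
open import Relation.Binary.Construct.Closure.ReflexiveTransitive using (Star; fold; ε; _◅_; _◅◅_)
open import Relation.Binary.Construct.Closure.ReflexiveTransitive.Properties using (◅◅-assoc)
open import Relation.Binary.PropositionalEquality
open import Relation.Binary.PropositionalEquality.WithK using (≡-irrelevant)
open import Relation.Nullary using (¬_; Dec; yes; no; ¬?)
open import Relation.Nullary.Decidable using (decidable-stable)
open import Relation.Nullary.Negation using (contradiction)
open import Relation.Unary using (Pred)

open import Defs

-- Repetition-free lists, and extrema and sizes up to double negation.

unique-lookup-injective : ∀ {A : Set} {xs : List A} → Unique xs →
  ∀ i j → lookup xs i ≡ lookup xs j → i ≡ j
unique-lookup-injective (_ ∷ _)   zero    zero    _  = refl
unique-lookup-injective (x∉ ∷ _)  zero    (suc j) eq = contradiction eq (All.lookup x∉ (∈-lookup j))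
unique-lookup-injective (x∉ ∷ _)  (suc i) zero    eq = contradiction (sym eq) (All.lookup x∉ (∈-lookup i))
unique-lookup-injective (_ ∷ xs!) (suc i) (suc j) eq = cong suc (unique-lookup-injective xs! i j eq)

unique-⊆⇒length≤ : ∀ {A : Set} {xs ys : List A} → Unique xs →
  (∀ {x} → x ∈ xs → x ∈ ys) → length xs ℕ.≤ length ys
unique-⊆⇒length≤ {xs = xs} {ys} xs! xs⊆ys = Fin.injective⇒≤ position-injective
  where
  position : Fin (length xs) → Fin (length ys)
  position i = Any.index (xs⊆ys (∈-lookup {xs = xs} i))

  position-injective : ∀ {i j} → position i ≡ position j → i ≡ j
  position-injective {i} {j} eq = unique-lookup-injective xs! i j (begin
    lookup xs i            ≡⟨ Any.lookup-index (xs⊆ys (∈-lookup i)) ⟩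
    lookup ys (position i) ≡⟨ cong (lookup ys) eq ⟩
    lookup ys (position j) ≡⟨ Any.lookup-index (xs⊆ys (∈-lookup j)) ⟨
    lookup xs j            ∎)
    where open ≡-Reasoning

unique-map : ∀ {A B : Set} (f : A → B) {xs : List A} → Unique xs →
  (∀ {x y} → x ∈ xs → y ∈ xs → f x ≡ f y → x ≡ y) → Unique (map f xs)
unique-map f []          inj = []
unique-map f (x∉ ∷ xs!) inj =
  All.map⁺ (All.tabulate λ y∈ eq → All.lookup x∉ y∈ (inj (here refl) (there y∈) eq))
  ∷ unique-map f xs! (λ x∈ y∈ → inj (there x∈) (there y∈))

-- Without a maximum, every number in `P` could be exchanged for a larger one. The sum `k + fuel`
-- stays above `B`, so when the fuel is used up, `k` itself has passed the bound.
¬¬-maximum : ∀ (P : Pred ℕ 0ℓ) B → (∀ k → P k → k ℕ.≤ B) → ∀ k → P k → ¬ ¬ ∃ (IsMaximum P)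
¬¬-maximum P B bound k pk none = go (suc B) k (ℕ.m≤n+m (suc B) k) pk
  where
  go : ∀ fuel k → B ℕ.< k ℕ.+ fuel → P k → ⊥
  go zero       k B< pk = ℕ.<⇒≱ B< (subst (ℕ._≤ B) (sym (ℕ.+-identityʳ k)) (bound k pk))
  go (suc fuel) k B< pk = none (k , pk , λ k′ pk′ → ℕ.≮⇒≥ λ k<k′ →
    go fuel k′ (ℕ.≤-trans B< (ℕ.≤-trans (ℕ.≤-reflexive (ℕ.+-suc k fuel)) (ℕ.+-monoˡ-≤ fuel k<k′))) pk′)

¬¬-minimum : ∀ (P : Pred ℕ 0ℓ) k → P k → ¬ ¬ ∃ (IsMinimum P)
¬¬-minimum P k pk none = go (suc k) k ℕ.≤-refl pk
  where
  go : ∀ fuel k → k ℕ.< fuel → P k → ⊥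
  go (suc fuel) k k< pk = none (k , pk , λ k′ pk′ → ℕ.≮⇒≥ λ k′<k →
    go fuel k′ (ℕ.<-≤-trans k′<k (ℕ.s≤s⁻¹ k<)) pk′)

-- A longest repetition-free list of elements of `P` contains all of them, since a missing element
-- could be put in front. Decidable equality settles membership in the list.
¬¬-size : ∀ {A : Set} → DecidableEquality A → (P : Pred A 0ℓ) → ∀ B →
  (∀ {xs} → Unique xs → All P xs → length xs ℕ.≤ B) →
  ∀ {xs} → Unique xs → All P xs → ¬ ¬ (∃[ k ] HasSize P k × length xs ℕ.≤ k)
¬¬-size {A} _≟_ P B bound {xs} xs! Pxs none =
  ¬¬-maximum Listed B (λ { _ (_ , ys! , Pys , refl) → bound ys! Pys }) (length xs) (xs , xs! , Pxs , refl)
    λ { (k , (ys , ys! , Pys , len) , max) → none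
      (k , (ys , ys! , (λ x → mk⇔ (All.lookup Pys) (complete ys! Pys (λ j p → subst (j ℕ.≤_) (sym len) (max j p)))) , len)
         , max _ (xs , xs! , Pxs , refl)) }
  where
  Listed : Pred ℕ 0ℓ
  Listed k = ∃[ ys ] Unique ys × All P ys × length ys ≡ k

  open import Data.List.Membership.DecPropositional _≟_ using (_∈?_)

  complete : ∀ {ys} → Unique ys → All P ys → (∀ k → Listed k → k ℕ.≤ length ys) → ∀ {x} → P x → x ∈ ys
  complete {ys} ys! Pys max {x} px with x ∈? ys
  ... | yes x∈ = x∈
  ... | no  x∉ = contradiction
    (max _ (x ∷ ys , All.¬Any⇒All¬ ys x∉ ∷ ys! , px ∷ Pys , refl)) ℕ.1+n≰n

-- The last step of a walk.

module _ {I : Set} {R : I → I → Set} where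

  private
    LastStep : I → I → Set
    LastStep i k = ∃[ j ] Star R i j × R j k

  ◅◅-identityʳ : ∀ {i j} (p : Star R i j) → p ◅◅ ε ≡ p
  ◅◅-identityʳ ε       = refl
  ◅◅-identityʳ (e ◅ p) = cong (e ◅_) (◅◅-identityʳ p)

  splitLast : ∀ {i j k} → R i j → Star R j k → LastStep i k
  splitLast e ε       = _ , ε , e
  splitLast e (f ◅ p) with splitLast f p
  ... | _ , q , g = _ , e ◅ q , g

  lastStep : ∀ {i k} → Star R i k → Maybe (LastStep i k)
  lastStep ε       = nothing
  lastStep (e ◅ p) = just (splitLast e p)

  splitLast-snoc : ∀ {i j k l} (e : R i j) (p : Star R j k) (f : R k l) →
    splitLast e (p ◅◅ (f ◅ ε)) ≡ (_ , e ◅ p , f)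
  splitLast-snoc e ε       f = refl
  splitLast-snoc e (g ◅ p) f rewrite splitLast-snoc g p f = refl

  lastStep-snoc : ∀ {i j k} (p : Star R i j) (e : R j k) →
    lastStep (p ◅◅ (e ◅ ε)) ≡ just (_ , p , e)
  lastStep-snoc ε       e = refl
  lastStep-snoc (f ◅ p) e = cong just (splitLast-snoc f p e)

  -- Walks are built from the front, so an equation between walks extended at the back cannot be
  -- matched on. The function `lastStep` reads off the last edge, and it is applied to both sides.
  -- The two middle nodes may differ, hence an equation of triples.
  snoc-injective : ∀ {i j j′ k} (p : Star R i j) {e : R j k} (q : Star R i j′) {f : R j′ k} →
    p ◅◅ (e ◅ ε) ≡ q ◅◅ (f ◅ ε) → _≡_ {A = LastStep i k} (_ , p , e) (_ , q , f)
  snoc-injective p {e} q {f} eq = just-injective (begin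
    just (_ , p , e)            ≡⟨ lastStep-snoc p e ⟨
    lastStep (p ◅◅ (e ◅ ε))     ≡⟨ cong lastStep eq ⟩
    lastStep (q ◅◅ (f ◅ ε))     ≡⟨ lastStep-snoc q f ⟩
    just (_ , q , f)            ∎)
    where open ≡-Reasoning

  splitLast-correct : ∀ {i j k} (e : R i j) (p : Star R j k) →
    let (_ , q , f) = splitLast e p in e ◅ p ≡ q ◅◅ (f ◅ ε)
  splitLast-correct e ε       = refl
  splitLast-correct e (f ◅ p) = cong (e ◅_) (splitLast-correct f p)

-- Inequalities between rationals.

p≤p+q : ∀ {p q} → 0ℚ ≤ q → p ≤ p + q
p≤p+q {p} {q} 0≤q = subst (_≤ p + q) (ℚ.+-identityʳ p) (ℚ.+-monoʳ-≤ p 0≤q)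

p<p+q : ∀ {p q} → 0ℚ < q → p < p + q
p<p+q {p} {q} 0<q = subst (_< p + q) (ℚ.+-identityʳ p) (ℚ.+-monoʳ-< p 0<q)

+-cancelʳ-≤ : ∀ r {p q} → p + r ≤ q + r → p ≤ q
+-cancelʳ-≤ r p+r≤q+r = ℚ.≮⇒≥ λ q<p → ℚ.<-irrefl refl (ℚ.<-≤-trans (ℚ.+-monoˡ-< r q<p) p+r≤q+r)

-- Shortest path trees and cuts in arbitrary weighted graphs.

module _ (G : WeightedGraph) where
  open WeightedGraph G

  weight-◅◅ : ∀ {u v w} (p : Walk u v) (q : Walk v w) → weight (p ◅◅ q) ≡ weight p + weight q
  weight-◅◅ ε       q = sym (ℚ.+-identityˡ _)
  weight-◅◅ (e ◅ p) q = trans (cong (ℓ e +_) (weight-◅◅ p q)) (sym (ℚ.+-assoc (ℓ e) _ _))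

  weight-◅ε : ∀ {u v} (e : Edge u v) → weight (e ◅ ε) ≡ ℓ e
  weight-◅ε e = ℚ.+-identityʳ (ℓ e)

  weight≥0 : ∀ {u v} (p : Walk u v) → 0ℚ ≤ weight p
  weight≥0 ε       = ℚ.≤-refl
  weight≥0 (e ◅ p) = ℚ.+-mono-≤ (ℚ.<⇒≤ (ℓ-pos e)) (weight≥0 p)

  dist≥0 : ∀ u v → 0ℚ ≤ dist u v
  dist≥0 u v = weight≥0 (shortest u v)

  shortest-unique : ∀ {u v} {p : Walk u v} → Shortest p → shortest u v ≡ p
  shortest-unique {u} {v} = proj₂ (proj₂ (unique-shortest u v))

  shortest-self : ∀ s → shortest s s ≡ ε
  shortest-self s = shortest-unique weight≥0

  -- A walk lighter than `p` could replace it in front of `q` and would give a lighter walk to `w`.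
  shortest-prefix : ∀ {s v w} (p : Walk s v) (q : Walk v w) → shortest s w ≡ p ◅◅ q → shortest s v ≡ p
  shortest-prefix {s} {v} {w} p q eq = shortest-unique λ p′ → +-cancelʳ-≤ (weight q) (begin
    weight p + weight q     ≡⟨ weight-◅◅ p q ⟨
    weight (p ◅◅ q)         ≡⟨ cong weight eq ⟨
    weight (shortest s w)   ≤⟨ proj₁ (proj₂ (unique-shortest s w)) (p′ ◅◅ q) ⟩
    weight (p′ ◅◅ q)        ≡⟨ weight-◅◅ p′ q ⟩
    weight p′ + weight q    ∎)
    where open ℚ.≤-Reasoning

  dist-◅◅ : ∀ {s v w} (p : Walk v w) → shortest s w ≡ shortest s v ◅◅ p → dist s w ≡ dist s v + weight p
  dist-◅◅ {s} {v} p eq = trans (cong weight eq) (weight-◅◅ (shortest s v) p)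

  dist-treeEdge : ∀ {s u v} (e : Edge u v) → TreeEdge G s e → dist s v ≡ dist s u + ℓ e
  dist-treeEdge {s} {u} e t = trans (dist-◅◅ (e ◅ ε) t) (cong (dist s u +_) (weight-◅ε e))

  predecessor : ∀ s v → s ≡ v ⊎ (∃[ u ] ∃[ e ] TreeEdge G s {u} {v} e)
  predecessor s v with shortest s v in eq
  ... | ε     = inj₁ refl
  ... | e ◅ p with splitLast e p | splitLast-correct e p
  ... | u , q , f | eq′ = inj₂ (u , f , trans eq′ (cong (_◅◅ (f ◅ ε)) (sym (shortest-prefix q (f ◅ ε) (trans eq eq′)))))

  treeEdge-unique : ∀ {s u u′ v} (e : Edge u v) (e′ : Edge u′ v) → TreeEdge G s e → TreeEdge G s e′ →
    _≡_ {A = ∃[ u ] Edge u v} (u , e) (u′ , e′)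
  treeEdge-unique e e′ t t′ = cong (λ (u , _ , e) → u , e) (snoc-injective _ _ (trans (sym t) t′))

  infix 4 _≟ᴾ_
  _≟ᴾ_ : DecidableEquality (Point G)
  node v ≟ᴾ node w with v Fin.≟ w
  ... | yes refl = yes refl
  ... | no v≢w   = no λ { refl → v≢w refl }
  node _ ≟ᴾ inside _ _ = no λ ()
  inside _ _ ≟ᴾ node _ = no λ ()
  inside {u} {v} e α ≟ᴾ inside {u′} {v′} e′ α′ with u Fin.≟ u′ | v Fin.≟ v′ | α ℚ.≟ α′
  ... | no u≢u′  | _        | _        = no λ { refl → u≢u′ refl }
  ... | yes _    | no v≢v′  | _        = no λ { refl → v≢v′ refl }
  ... | yes _    | yes _    | no α≢α′  = no λ { refl → α≢α′ refl }
  ... | yes refl | yes refl | yes refl = yes (cong (λ e → inside e α) (irrelevant e e′))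

  far : Point G → V
  far (node v)         = v
  far (inside {v = v} _ _) = v

  -- Only one tree edge enters a node, and on that edge the depth `r` determines the offset. The far
  -- end itself is strictly deeper than every point inside the edge, so the mixed cases are
  -- impossible.
  far-injective : ∀ {s r x y} → Cut G s r x → Cut G s r y → far x ≡ far y → x ≡ y
  far-injective {x = node v} {node v} _ _ refl = refl
  far-injective {s} {r} {node v} {inside {u} e α} (_ , refl) ((inside t 0<α α<ℓ , _) , eq) refl =
    contradiction (trans eq (dist-treeEdge e t)) (ℚ.<⇒≢ (ℚ.+-monoʳ-< (dist s u) α<ℓ))
  far-injective {s} {r} {inside {u} e α} {node v} ((inside t 0<α α<ℓ , _) , eq) (_ , refl) refl =
    contradiction (trans eq (dist-treeEdge e t)) (ℚ.<⇒≢ (ℚ.+-monoʳ-< (dist s u) α<ℓ))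
  far-injective {s} {r} {inside {u} e α} {inside e′ α′} ((inside t _ _ , _) , eq) ((inside t′ _ _ , _) , eq′) refl
    with refl ← treeEdge-unique e e′ t t′ = cong (inside e) (∙-cancelˡ (dist s u) α α′ (trans eq (sym eq′)))
    where open import Algebra.Properties.Group ℚ.+-0-group using (∙-cancelˡ)

  far-unique : ∀ {s r xs} → Unique xs → All (Cut G s r) xs → Unique (map far xs)
  far-unique xs! cut = unique-map far xs! λ x∈ y∈ → far-injective (All.lookup cut x∈) (All.lookup cut y∈)

  -- Distinct points of a cut have distinct far ends. This crude bound makes cut sizes and the
  -- skeleton dimension exist up to double negation.
  cut-length≤n : ∀ {s r xs} → Unique xs → All (Cut G s r) xs → length xs ℕ.≤ n
  cut-length≤n {xs = xs} xs! cut = begin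
    length xs           ≡⟨ length-map far xs ⟨
    length (map far xs) ≤⟨ unique-⊆⇒length≤ (far-unique xs! cut) (λ _ → ∈-allFin _) ⟩
    length (allFin n)   ≡⟨ length-tabulate {n = n} (λ i → i) ⟩
    n                   ∎
    where open ℕ.≤-Reasoning

  cut-bound : ∀ {s r k b} → HasSize (Cut G s r) k →
    (∀ {xs} → Unique xs → All (Cut G s r) xs → length xs ℕ.≤ b) → k ℕ.≤ b
  cut-bound (xs , xs! , xs⇔ , refl) bound = bound xs! (All.tabulate (Equivalence.to (xs⇔ _)))

  -- The cut through `xs` first gets a size, which starts the search for the maximum over all cuts.
  -- The bound by `length xs` is passed along for the lower bound on combs.
  ¬¬-skeletonDimension : ∀ {s r xs} → 0ℚ ≤ r → Unique xs → All (Cut G s r) xs →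
    ¬ ¬ (∃[ k ] IsSkeletonDimension G k × length xs ℕ.≤ k)
  ¬¬-skeletonDimension {s} {r} 0≤r xs! cut none =
    ¬¬-size _≟ᴾ_ (Cut G s r) n cut-length≤n xs! cut λ (k , size , len≤k) →
    ¬¬-maximum _ n (λ _ (_ , _ , _ , size) → cut-bound size cut-length≤n) k (s , r , 0≤r , size)
      λ (κ , isκ) → none (κ , isκ , ℕ.≤-trans len≤k (proj₂ isκ k (s , r , 0≤r , size)))

-- Stretch and bandwidth.

module _ (G : Graph) where
  open Graph G

  stretch-edge : ∀ (f : Permutation′ n) {u v} → Edge u v →
    ℕ.∣ toℕ (f ⟨$⟩ʳ u) - toℕ (f ⟨$⟩ʳ v) ∣ ℕ.≤ stretch G f
  stretch-edge f {u} {v} e = All.lookup (xs≤max 0 _)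
    (∈-map⁺ _ (∈-filter⁺ (uncurry edge?) (∈-cartesianProduct⁺ (∈-allFin u) (∈-allFin v)) e))

  stretch-bound : ∀ (f : Permutation′ n) b →
    (∀ {u v} → Edge u v → ℕ.∣ toℕ (f ⟨$⟩ʳ u) - toℕ (f ⟨$⟩ʳ v) ∣ ℕ.≤ b) → stretch G f ℕ.≤ b
  stretch-bound f b bound = max≤v⁺ ℕ.z≤n (All.map⁺ (All.tabulate λ e∈ →
    bound (proj₂ (∈-filter⁻ (uncurry edge?) {xs = cartesianProduct (allFin n) (allFin n)} e∈))))

¬¬-bandwidth : ∀ (G : WeightedGraph) → ¬ ¬ ∃ (Bandwidth G)
¬¬-bandwidth G = ¬¬-minimum _ (stretch graph id) (id , refl)
  where open WeightedGraph G

-- Weighted trees given by parent functions.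

module Tree
  {m : ℕ} (parent : Fin m → Fin (suc m)) (parent≤ : ∀ k → toℕ (parent k) ℕ.≤ toℕ k)
  (len : Fin m → ℚ) (len>0 : ∀ k → 0ℚ < len k)
  where

  -- Node `zero` is the root, and edge `k` joins `suc k` to its parent. The parent equation is an
  -- argument, so that matching on a link does not have to invert `parent`.
  data Link : Fin (suc m) → Fin (suc m) → Set where
    down : ∀ {k u} → parent k ≡ u → Link u (suc k)
    up   : ∀ {k u} → parent k ≡ u → Link (suc k) u

  link? : ∀ u v → Dec (Link u v)
  link? zero    zero    = no λ ()
  link? zero    (suc j) with parent j Fin.≟ zero
  ... | yes p = yes (down p)
  ... | no ¬p = no λ { (down p) → ¬p p }
  link? (suc k) zero with parent k Fin.≟ zero
  ... | yes p = yes (up p)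
  ... | no ¬p = no λ { (up p) → ¬p p }
  link? (suc k) (suc j) with parent k Fin.≟ suc j | parent j Fin.≟ suc k
  ... | yes p | _     = yes (up p)
  ... | no _  | yes q = yes (down q)
  ... | no ¬p | no ¬q = no λ { (up p) → ¬p p ; (down q) → ¬q q }

  parent< : ∀ {k u} → parent k ≡ u → toℕ u ℕ.< suc (toℕ k)
  parent< {k} refl = ℕ.s≤s (parent≤ k)

  parent-asym : ∀ {k j} → parent k ≡ suc j → ¬ parent j ≡ suc k
  parent-asym p q = ℕ.<-asym (parent< p) (parent< q)

  link-irrelevant : ∀ {u v} (e f : Link u v) → e ≡ f
  link-irrelevant (down p) (down q) = cong down (≡-irrelevant p q)
  link-irrelevant (down p) (up q)   = contradiction q (parent-asym p)
  link-irrelevant (up p)   (down q) = contradiction q (parent-asym p)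
  link-irrelevant (up p)   (up q)   = cong up (≡-irrelevant p q)

  flip : ∀ {u v} → Link u v → Link v u
  flip (down p) = up p
  flip (up p)   = down p

  loopless : ∀ {v} → ¬ Link v v
  loopless (down p) = ℕ.<-irrefl refl (parent< p)
  loopless (up p)   = ℕ.<-irrefl refl (parent< p)

  length-of : ∀ {u v} → Link u v → ℚ
  length-of (down {k} _) = len k
  length-of (up {k} _)   = len k

  length-flip : ∀ {u v} (e : Link u v) → length-of (flip e) ≡ length-of e
  length-flip (down _) = refl
  length-flip (up _)   = refl

  length>0 : ∀ {u v} (e : Link u v) → 0ℚ < length-of e
  length>0 (down _) = len>0 _
  length>0 (up _)   = len>0 _

  -- The tree path from u to v, found by repeatedly moving the larger of the
  -- two nodes to its parent.
  data Path : Fin (suc m) → Fin (suc m) → Set where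
    stay : ∀ {u} → Path u u
    rise : ∀ {k v} → toℕ v ℕ.< suc (toℕ k) → Path (parent k) v → Path (suc k) v
    fall : ∀ {u k} → toℕ u ℕ.< suc (toℕ k) → Path u (parent k) → Path u (suc k)

  -- The order of the numbers of the two ends decides which constructor applies.
  path-irrelevant : ∀ {u v} (p q : Path u v) → p ≡ q
  path-irrelevant stay       stay        = refl
  path-irrelevant stay       (rise lt _) = contradiction lt (ℕ.<-irrefl refl)
  path-irrelevant stay       (fall lt _) = contradiction lt (ℕ.<-irrefl refl)
  path-irrelevant (rise lt _) stay       = contradiction lt (ℕ.<-irrefl refl)
  path-irrelevant (fall lt _) stay       = contradiction lt (ℕ.<-irrefl refl)
  path-irrelevant (rise lt p) (rise lt′ q) = cong₂ rise (ℕ.<-irrelevant lt lt′) (path-irrelevant p q)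
  path-irrelevant (rise lt _) (fall gt _)  = contradiction gt (ℕ.<-asym lt)
  path-irrelevant (fall lt _) (rise gt _)  = contradiction gt (ℕ.<-asym lt)
  path-irrelevant (fall lt p) (fall lt′ q) = cong₂ fall (ℕ.<-irrelevant lt lt′) (path-irrelevant p q)

  path : ∀ u v → Path u v
  path u v = go (suc (toℕ u ℕ.+ toℕ v)) u v ℕ.≤-refl
    where
    go : ∀ fuel u v → toℕ u ℕ.+ toℕ v ℕ.< fuel → Path u v
    go (suc fuel) u v (ℕ.s≤s bound) with ℕ.<-cmp (toℕ u) (toℕ v)
    go (suc fuel) u (suc k) (ℕ.s≤s bound) | tri< u<v _ _ = fall u<v
      (go fuel u (parent k) (ℕ.<-≤-trans (ℕ.+-monoʳ-< (toℕ u) (parent< refl)) bound))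
    go (suc fuel) u v _ | tri≈ _ eq _ with refl ← Fin.toℕ-injective eq = stay
    go (suc fuel) (suc k) v (ℕ.s≤s bound) | tri> _ _ v<u = rise v<u
      (go fuel (parent k) v (ℕ.<-≤-trans (ℕ.+-monoˡ-< (toℕ v) (parent< refl)) bound))

  walk : ∀ {u v} → Path u v → Star Link u v
  walk stay       = ε
  walk (rise _ p) = up refl ◅ walk p
  walk (fall _ p) = walk p ◅◅ (down refl ◅ ε)

  walk-irrelevant : ∀ {u v} (p q : Path u v) → walk p ≡ walk q
  walk-irrelevant p q = cong walk (path-irrelevant p q)

  -- An edge separates the tree, and `v` lies on one side of it: either the path from `suc k` starts
  -- by going up the edge, or the path from the parent starts by going down it.
  walk-link : ∀ {k v} (p : Path (suc k) v) (q : Path (parent k) v) →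
    walk p ≡ up refl ◅ walk q ⊎ walk q ≡ down refl ◅ walk p
  walk-link stay q = inj₂ (walk-irrelevant q (fall (parent< refl) stay))
  walk-link (rise _ p) q = inj₁ (cong (up refl ◅_) (walk-irrelevant p q))
  -- The number of `parent k` is below that of `suc j` as well, so both paths end with the same edge
  -- down, and the claim for `parent j` carries over.
  walk-link {k} (fall {k = j} lt p) q
    with q′ ← path (parent k) (parent j)
    with refl ← path-irrelevant q (fall (ℕ.<-trans (parent< refl) lt) q′)
    with walk-link p q′
  ... | inj₁ eq = inj₁ (cong (_◅◅ (down refl ◅ ε)) eq)
  ... | inj₂ eq = inj₂ (cong (_◅◅ (down refl ◅ ε)) eq)

  walk-step : ∀ {u u′ v} (e : Link u u′) (p : Path u v) (q : Path u′ v) →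
    walk p ≡ e ◅ walk q ⊎ walk q ≡ flip e ◅ walk p
  walk-step (down refl) p q with walk-link q p
  ... | inj₁ eq = inj₂ eq
  ... | inj₂ eq = inj₁ eq
  walk-step (up refl) p q = walk-link p q

  weightOf : ∀ {u v} → Star Link u v → ℚ
  weightOf = fold (λ _ _ → ℚ) (λ e d → length-of e + d) 0ℚ

  -- If the tree path starts with the first edge of the walk, induction applies to the rest.
  -- Otherwise the tree path from `u′` leads back over that edge, so the walk makes a detour and is
  -- strictly heavier. The alternative of lighter or equal yields minimality and uniqueness
  -- together.
  walk-minimal : ∀ {u v} (p : Path u v) (w : Star Link u v) →
    weightOf (walk p) < weightOf w ⊎ walk p ≡ w
  walk-minimal p ε = inj₂ (walk-irrelevant p stay)
  walk-minimal {u} {v} p (_◅_ {j = u′} e w) with walk-step e p (path u′ v) | walk-minimal (path u′ v) w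
  ... | inj₁ eq | inj₁ lt   = inj₁ (subst (λ p → weightOf p < _) (sym eq) (ℚ.+-monoʳ-< (length-of e) lt))
  ... | inj₁ eq | inj₂ refl = inj₂ eq
  ... | inj₂ eq | le = inj₁ (begin-strict
    weightOf (walk p)                          <⟨ p<q+p (length>0 (flip e)) ⟩
    length-of (flip e) + weightOf (walk p)     ≡⟨ cong weightOf eq ⟨
    weightOf (walk (path u′ v))                ≤⟨ ≤-of le ⟩
    weightOf w                                 <⟨ p<q+p (length>0 e) ⟩
    length-of e + weightOf w                   ∎)
    where
    open ℚ.≤-Reasoning

    p<q+p : ∀ {p q} → 0ℚ < q → p < q + p
    p<q+p {p} {q} 0<q = subst (p <_) (ℚ.+-comm p q) (p<p+q 0<q)

    ≤-of : ∀ {w′} → weightOf w′ < weightOf w ⊎ w′ ≡ w → weightOf w′ ≤ weightOf w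
    ≤-of (inj₁ lt)   = ℚ.<⇒≤ lt
    ≤-of (inj₂ refl) = ℚ.≤-refl

  graph : Graph
  graph = record
    { n          = suc m
    ; Edge       = Link
    ; edge?      = link?
    ; irrelevant = link-irrelevant
    ; symmetric  = flip
    ; loopless   = loopless
    }

  tree : WeightedGraph
  tree = record
    { graph           = graph
    ; ℓ               = length-of
    ; ℓ-sym           = length-flip
    ; ℓ-pos           = length>0
    ; connected       = λ u v → walk (path u v)
    ; unique-shortest = λ u v → walk (path u v) , minimal , unique
    }
    where
    minimal : ∀ {u v} (w : Star Link u v) → weightOf (walk (path u v)) ≤ weightOf w
    minimal {u} {v} w with walk-minimal (path u v) w
    ... | inj₁ lt = ℚ.<⇒≤ lt
    ... | inj₂ eq = ℚ.≤-reflexive (cong weightOf eq)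

    unique : ∀ {u v} {w : Star Link u v} → (∀ w′ → weightOf w ≤ weightOf w′) → walk (path u v) ≡ w
    unique {u} {v} {w} w-minimal with walk-minimal (path u v) w
    ... | inj₁ lt = contradiction (ℚ.<-≤-trans lt (w-minimal (walk (path u v)))) (ℚ.<-irrefl refl)
    ... | inj₂ eq = eq

  open WeightedGraph tree using (V; Walk; weight; shortest; dist)

  shortest-walk : ∀ {u v} (p : Path u v) → shortest u v ≡ walk p
  shortest-walk p = walk-irrelevant (path _ _) p

  tree-metric : IsMetric tree
  tree-metric (down {k} refl) = sym (begin
    weight (shortest (parent k) (suc k)) ≡⟨ cong weight (shortest-walk (fall (parent< refl) stay)) ⟩
    len k + 0ℚ                           ≡⟨ ℚ.+-identityʳ (len k) ⟩
    len k                                ∎)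
    where open ≡-Reasoning
  tree-metric (up {k} refl) = sym (begin
    weight (shortest (suc k) (parent k)) ≡⟨ cong weight (shortest-walk (rise (parent< refl) stay)) ⟩
    len k + 0ℚ                           ≡⟨ ℚ.+-identityʳ (len k) ⟩
    len k                                ∎)
    where open ≡-Reasoning

  Descending : V → Fin m → Set
  Descending s k = TreeEdge tree s (down {k} refl)

  descending-from-root : ∀ k → Descending zero k
  descending-from-root k = shortest-walk (fall ℕ.z<s (path zero (parent k)))

  -- Rising walks from `s` are the initial segments of the path from `s` to the root.
  data Rising : ∀ {u v} → Walk u v → Set where
    ε   : ∀ {u} → Rising (ε {x = u})
    _◅_ : ∀ {k u v} (eq : parent k ≡ u) {p : Walk u v} → Rising p → Rising (up eq ◅ p)

  -- A tree path first rises and then falls, so it either never falls or ends with an edge traversed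
  -- downwards.
  rising-or-descending : ∀ s v → Rising (shortest s v) ⊎ (∃[ k ] v ≡ suc k × Descending s k)
  rising-or-descending s v = go (path s v)
    where
    go : ∀ {s v} (p : Path s v) → Rising (walk p) ⊎ (∃[ k ] v ≡ suc k × Descending s k)
    go stay = inj₁ ε
    go (fall {k = k} lt p) = inj₂ (k , refl , shortest-walk (fall lt (path _ (parent k))))
    go (rise {k} lt p) with go p
    ... | inj₁ rising = inj₁ (refl ◅ rising)
    ... | inj₂ (j , refl , desc) = inj₂ (j , refl , (begin
      shortest (suc k) (suc j)                                ≡⟨ shortest-walk (rise lt (path (parent k) (suc j))) ⟩
      up refl ◅ shortest (parent k) (suc j)                   ≡⟨ cong (up refl ◅_) desc ⟩
      up refl ◅ shortest (parent k) (parent j) ◅◅ (down refl ◅ ε)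
        ≡⟨ cong (_◅◅ (down refl ◅ ε)) (shortest-walk (rise (ℕ.<-trans (parent< refl) lt) (path (parent k) (parent j)))) ⟨
      shortest (suc k) (parent j) ◅◅ (down refl ◅ ε)           ∎))
      where open ≡-Reasoning

  -- If the edge were a tree edge in both directions, each of its ends would be farther from `s`
  -- than the other.
  no-turn-up : ∀ {s k} → Descending s k → ¬ TreeEdge tree s (up {k} refl)
  no-turn-up {s} {k} t t′ = ℚ.<-irrefl refl (begin-strict
    dist s (parent k)                   <⟨ p<p+q (len>0 k) ⟩
    dist s (parent k) + len k           ≡⟨ dist-treeEdge tree (down refl) t ⟨
    dist s (suc k)                      <⟨ p<p+q (len>0 k) ⟩
    dist s (suc k) + len k              ≡⟨ dist-treeEdge tree (up refl) t′ ⟨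
    dist s (parent k)                   ∎)
    where open ℚ.≤-Reasoning

  rising-before-up : ∀ {s k} → TreeEdge tree s (up {k} refl) → Rising (shortest s (suc k))
  rising-before-up {s} {k} t with rising-or-descending s (suc k)
  ... | inj₁ rising           = rising
  ... | inj₂ (k , refl , t′) = contradiction t (no-turn-up t′)

  rising-≤ : ∀ {u v} {p : Walk u v} → Rising p → toℕ v ℕ.≤ toℕ u
  rising-≤ ε           = ℕ.≤-refl
  rising-≤ (eq ◅ r)    = ℕ.≤-trans (rising-≤ r) (ℕ.<⇒≤ (parent< eq))

  -- Both walks follow the path from `s` to the root, along which numbers decrease. Hence `u` comes
  -- after `suc k`, and reaching it takes at least the parent edge of `suc k` in addition.
  rising-comparable : ∀ {s u k} {p : Walk s u} {q : Walk s (suc k)} → Rising p → Rising q →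
    toℕ u ℕ.< suc (toℕ k) → weight q + len k ≤ weight p
  rising-comparable ε ε lt = contradiction lt (ℕ.<-irrefl refl)
  rising-comparable ε q@(_ ◅ _) lt = contradiction (rising-≤ q) (ℕ.<⇒≱ lt)
  rising-comparable {k = k} (_◅_ {k} eq {p} _) ε lt = begin
    0ℚ + len k       ≡⟨ ℚ.+-identityˡ (len k) ⟩
    len k            ≤⟨ p≤p+q (weight≥0 tree p) ⟩
    len k + weight p ∎
    where open ℚ.≤-Reasoning
  rising-comparable {k = k} (_◅_ {j} refl {p} rp) (_◅_ refl {q} rq) lt = begin
    len j + weight q + len k   ≡⟨ ℚ.+-assoc (len j) (weight q) (len k) ⟩
    len j + (weight q + len k) ≤⟨ ℚ.+-monoʳ-≤ (len j) (rising-comparable rp rq lt) ⟩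
    len j + weight p           ∎
    where open ℚ.≤-Reasoning

  -- Skeletons of trees in which each edge has at most a third of the length of its parent edge.

  module Contracting
    (shrink : ∀ {k j} → parent k ≡ suc j → len k + (len k + len k) ≤ len j)
    where

    -- If the next edge down has length `l`, the part after it weighs less than half of `l` by
    -- induction. Twice the total is then less than three times `l`, hence less than `len k` by
    -- `shrink`. Doubling avoids fractions.
    below-weight : ∀ {s k w} → Descending s k → (p : Walk (suc k) w) →
      shortest s w ≡ shortest s (suc k) ◅◅ p → weight p + weight p < len k
    below-weight {k = k} t ε eq = len>0 k
    below-weight {s} {k} t (up refl ◅ p) eq = contradiction
      (shortest-prefix tree (shortest s (suc k) ◅◅ (up refl ◅ ε)) p (trans eq (sym (◅◅-assoc (shortest s (suc k)) _ p))))
      (no-turn-up t)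
    below-weight {s} {k} t (down {j} p≡ ◅ p) eq = begin-strict
      (len j + weight p) + (len j + weight p)
        ≡⟨ solve 2 (λ l w → (l :+ w) :+ (l :+ w) := (l :+ l) :+ (w :+ w)) refl (len j) (weight p) ⟩
      (len j + len j) + (weight p + weight p)
        <⟨ ℚ.+-monoʳ-< (len j + len j) (below-weight t′ p eq′) ⟩
      (len j + len j) + len j  ≡⟨ ℚ.+-assoc (len j) (len j) (len j) ⟩
      len j + (len j + len j)  ≤⟨ shrink p≡ ⟩
      len k                    ∎
      where
      open ℚ.≤-Reasoning
      open +-*-Solver

      assoc : shortest s _ ≡ (shortest s (suc k) ◅◅ (down p≡ ◅ ε)) ◅◅ p
      assoc = trans eq (sym (◅◅-assoc (shortest s (suc k)) (down p≡ ◅ ε) p))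

      prefix : TreeEdge tree s (down p≡)
      prefix = shortest-prefix tree (shortest s (suc k) ◅◅ (down p≡ ◅ ε)) p assoc

      t′ : Descending s j
      t′ = desc p≡ prefix
        where
        desc : ∀ {u} (p : parent j ≡ u) → TreeEdge tree s (down p) → Descending s j
        desc refl t = t

      eq′ : shortest s _ ≡ shortest s (suc j) ◅◅ p
      eq′ = trans assoc (cong (_◅◅ p) (sym prefix))

    -- A point inside an edge is passed on the way to the far end of that edge, so the bound for the
    -- far end covers it.
    below-node : ∀ {s k w d} → Descending s k → InTree tree s w →
      Descends tree s (node (suc k)) w d → d + d < len k
    below-node t (node w) (node-node p eq) = below-weight t p eq
    below-node {s} {k} t (inside {u} {v} {β} {e} t′ 0<β β<ℓ) (node-inside (node-node p eq)) = begin-strict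
      (weight p + β) + (weight p + β)
        <⟨ ℚ.+-mono-< (ℚ.+-monoʳ-< (weight p) β<ℓ) (ℚ.+-monoʳ-< (weight p) β<ℓ) ⟩
      (weight p + length-of e) + (weight p + length-of e)
        ≡⟨ cong₂ _+_ weight-snoc weight-snoc ⟨
      weight (p ◅◅ (e ◅ ε)) + weight (p ◅◅ (e ◅ ε))
        <⟨ below-weight t (p ◅◅ (e ◅ ε)) (trans t′ (trans (cong (_◅◅ (e ◅ ε)) eq) (◅◅-assoc (shortest s (suc k)) p (e ◅ ε)))) ⟩
      len k ∎
      where
      open ℚ.≤-Reasoning
      weight-snoc : weight (p ◅◅ (e ◅ ε)) ≡ weight p + length-of e
      weight-snoc = trans (weight-◅◅ tree p (e ◅ ε)) (cong (weight p +_) (weight-◅ε tree e))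

    halve : ∀ {x d} → ½ * x ≤ d → x ≤ d + d
    halve {x} {d} ½x≤d = subst (_≤ d + d) (solve 1 (λ x → con ½ :* x :+ con ½ :* x := x) refl x) (ℚ.+-mono-≤ ½x≤d ½x≤d)
      where open +-*-Solver

    below-segment : ∀ {l α d} → 0ℚ < l → 0ℚ < α → d + d < l → ((l - α) + d) + ((l - α) + d) < l + (l + l)
    below-segment {l} {α} {d} 0<l 0<α 2d<l = begin-strict
      ((l - α) + d) + ((l - α) + d)
        <⟨ ℚ.+-mono-< (ℚ.+-monoˡ-< d l-α<l) (ℚ.+-monoˡ-< d l-α<l) ⟩
      (l + d) + (l + d)
        ≡⟨ solve 2 (λ l d → (l :+ d) :+ (l :+ d) := (d :+ d) :+ (l :+ l)) refl l d ⟩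
      (d + d) + (l + l)             <⟨ ℚ.+-monoˡ-< (l + l) 2d<l ⟩
      l + (l + l)                   ∎
      where
      open ℚ.≤-Reasoning
      open +-*-Solver
      l-α<l : l - α < l
      l-α<l = subst (l - α <_) (solve 2 (λ l α → (l :- α) :+ α := l) refl l α) (p<p+q 0<α)

    below-inside : ∀ {s k w α d} → Descending s k → 0ℚ < α → InTree tree s w →
      Descends tree s (inside (down {k} refl) α) w d → d + d < len k + (len k + len k)
    below-inside {k = k} t 0<α w∈ (inside-node desc) = below-segment (len>0 k) 0<α (below-node t w∈ desc)
    below-inside {k = k} {α = α} t 0<α w∈ (inside-inside {d = d} {β = β} desc) =
      subst (λ x → x + x < _) (sym (ℚ.+-assoc (len k - α) d β))
        (below-segment (len>0 k) 0<α (below-node t w∈ (node-inside desc)))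
    -- The descendant lies on the same edge before its lower end, so it is nearer than that end,
    -- which is the case `d = 0ℚ`.
    below-inside {k = k} {α = α} t 0<α (inside _ _ β<ℓ) (same-edge {β = β} α≤β) =
      subst (λ x → x + x < _) (ℚ.+-identityʳ (β - α)) (ℚ.<-trans
        (ℚ.+-mono-< step step)
        (below-segment {d = 0ℚ} (len>0 k) 0<α (len>0 k)))
      where
      step : (β - α) + 0ℚ < (len k - α) + 0ℚ
      step = ℚ.+-monoˡ-< 0ℚ (ℚ.+-monoˡ-< (ℚ.- α) β<ℓ)

    dist≥len : ∀ {s k} → Descending s k → len k ≤ dist s (suc k)
    dist≥len {s} {k} t = begin
      len k                    ≡⟨ ℚ.+-identityˡ (len k) ⟨
      0ℚ + len k               ≤⟨ ℚ.+-monoˡ-≤ (len k) (dist≥0 tree s (parent k)) ⟩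
      dist s (parent k) + len k ≡⟨ dist-treeEdge tree (down refl) t ⟨
      dist s (suc k)           ∎
      where open ℚ.≤-Reasoning

    -- What is kept of a cut point with far end `v`: its edge starts on the path from `s` to the
    -- root and covers the radius `r`. The interval is closed at `v`, to include the point that is
    -- `v` itself.
    Located : V → ℚ → V → Set
    Located s r v = ∃[ u ] ∃[ e ] TreeEdge tree s {u} {v} e × Rising (shortest s u) × dist s u < r × r ≤ dist s v

    -- A node entered downwards through edge `k` has depth at least `len k`, while twice any
    -- distance below it is less than `len k`. So it is not in the skeleton.
    node-located : ∀ {s v} → InSkeleton tree s (node v) → v ≡ s ⊎ Located s (dist s v) v
    node-located {s} {v} (_ , w , d , w∈ , desc , half) with predecessor tree s v
    ... | inj₁ refl = inj₁ refl
    ... | inj₂ (u , down {k} refl , t) = contradiction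
      (ℚ.≤-<-trans (ℚ.≤-trans (dist≥len t) (halve half)) (below-node t w∈ desc)) (ℚ.<-irrefl refl)
    ... | inj₂ (u , up {k} refl , t) = inj₂ (u , up refl , t , rising-before-up t ,
      subst (dist s u <_) (sym (dist-treeEdge tree (up refl) t)) (p<p+q (len>0 k)) , ℚ.≤-refl)

    -- The critical case is a downward edge `k` whose upper end was itself entered downwards,
    -- through an edge `j`. The point is then deeper than `len j`, but twice the distance to a
    -- descendant is less than three times `len k`, which is at most `len j`.
    inside-located : ∀ {s u v α} {e : Link u v} → InSkeleton tree s (inside e α) → Located s (dist s u + α) v
    inside-located {s} {u} {v} {α} {e} (inside t 0<α α<ℓ , w , d , w∈ , desc , half) =
      u , e , t , rising e t desc , p<p+q 0<α ,
      ℚ.≤-trans (ℚ.<⇒≤ (ℚ.+-monoʳ-< (dist s u) α<ℓ)) (ℚ.≤-reflexive (sym (dist-treeEdge tree e t)))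
      where
      rising : (e : Link u v) → TreeEdge tree s e → Descends tree s (inside e α) w d → Rising (shortest s u)
      rising (up refl) t desc = rising-before-up t
      rising (down {k} refl) t desc with rising-or-descending s (parent k)
      ... | inj₁ r = r
      ... | inj₂ (j , p≡ , t′) = contradiction (begin-strict
        len j                     ≤⟨ dist≥len t′ ⟩
        dist s (suc j)            ≡⟨ cong (dist s) p≡ ⟨
        dist s (parent k)         <⟨ p<p+q 0<α ⟩
        dist s (parent k) + α     ≤⟨ halve half ⟩
        d + d                     <⟨ below-inside t 0<α w∈ desc ⟩
        len k + (len k + len k)   ≤⟨ shrink p≡ ⟩
        len j                     ∎) (ℚ.<-irrefl refl)
        where open ℚ.≤-Reasoning

    located : ∀ {s r x} → Cut tree s r x → far tree x ≡ s ⊎ Located s r (far tree x)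
    located {x = node v}     (x∈ , refl) = node-located x∈
    located {x = inside _ _} (x∈ , refl) = inj₂ (inside-located x∈)

    link-≤ : ∀ {k v} (e : Link (suc k) v) → length-of e ≤ len k
    link-≤ (up refl)       = ℚ.≤-refl
    link-≤ (down {j} p≡) = ℚ.≤-trans (p≤p+q (ℚ.<⇒≤ (ℚ.+-mono-< (len>0 j) (len>0 j)))) (shrink p≡)

    -- If `u` came later on the path to the root than `u′`, then, as by `link-≤` no edge leaving
    -- `u′` is longer than its parent edge, `u` would be at least as far from `s` as `v′`. But `u`
    -- is nearer than `r`, and `v′` is not.
    predecessor-≮ : ∀ {s r v v′} (l : Located s r v) (l′ : Located s r v′) → ¬ toℕ (proj₁ l) ℕ.< toℕ (proj₁ l′)
    predecessor-≮ {s} {r} {v} {v′} (u , _ , _ , ru , u<r , _) (suc k , e′ , t′ , ru′ , _ , r≤v′) u<u′ =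
      ℚ.<-irrefl refl (begin-strict
        dist s u                  <⟨ u<r ⟩
        r                         ≤⟨ r≤v′ ⟩
        dist s v′                 ≡⟨ dist-treeEdge tree e′ t′ ⟩
        dist s (suc k) + length-of e′  ≤⟨ ℚ.+-monoʳ-≤ (dist s (suc k)) (link-≤ e′) ⟩
        dist s (suc k) + len k    ≤⟨ rising-comparable ru ru′ u<u′ ⟩
        dist s u                  ∎)
      where open ℚ.≤-Reasoning

    same-predecessor : ∀ {s r v v′} (l : Located s r v) (l′ : Located s r v′) → proj₁ l ≡ proj₁ l′
    same-predecessor l l′ = Fin.toℕ-injective
      (ℕ.≤-antisym (ℕ.≮⇒≥ (predecessor-≮ l′ l)) (ℕ.≮⇒≥ (predecessor-≮ l l′)))

    -- All far ends other than `s` are neighbours of one common predecessor, and far ends are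
    -- distinct. The additional 1 accounts for `s`.
    cut-length : ∀ {D} (neighbours : V → List ℕ) → (∀ u → length (neighbours u) ℕ.≤ D) →
      (∀ {u v} → Link u v → toℕ v ∈ neighbours u) →
      ∀ {s r xs} → Unique xs → All (Cut tree s r) xs → length xs ℕ.≤ suc D
    cut-length {D} neighbours short complete {s} {r} {xs} xs! cut = begin
      length xs                    ≡⟨ length-map index xs ⟨
      length (map index xs)        ≤⟨ bound (Any.any? (λ x → ¬? (far tree x Fin.≟ s)) xs) ⟩
      suc D                        ∎
      where
      open ℕ.≤-Reasoning

      index : Point tree → ℕ
      index = toℕ ∘ far tree

      indices! : Unique (map index xs)
      indices! = unique-map index xs! λ x∈ y∈ eq →
        far-injective tree (All.lookup cut x∈) (All.lookup cut y∈) (Fin.toℕ-injective eq)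

      near : ∀ (ns : List ℕ) → (∀ {x} → x ∈ xs → index x ∈ toℕ s ∷ ns) → length (map index xs) ℕ.≤ suc (length ns)
      near ns sub = unique-⊆⇒length≤ indices! λ i∈ → case ∈-map⁻ index i∈ of λ { (x , x∈ , refl) → sub x∈ }

      -- A cut point whose far end differs from `s` is needed to name the common predecessor.
      -- Without one, the cut has at most one point.
      bound : Dec (Any (λ x → ¬ far tree x ≡ s) xs) → length (map index xs) ℕ.≤ suc D
      bound (no none) = ℕ.≤-trans (near [] λ {x} x∈ → here (cong toℕ
        (decidable-stable (far tree x Fin.≟ s) λ x≢s → none (lose x∈ x≢s)))) (ℕ.s≤s ℕ.z≤n)
      bound (yes some) with find some
      ... | x , x∈ , x≢s with located (All.lookup cut x∈)
      ... | inj₁ x≡s = contradiction x≡s x≢s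
      ... | inj₂ l = ℕ.≤-trans (near (neighbours (proj₁ l)) sub) (ℕ.s≤s (short (proj₁ l)))
        where
        sub : ∀ {y} → y ∈ xs → index y ∈ toℕ s ∷ neighbours (proj₁ l)
        sub y∈ with located (All.lookup cut y∈)
        ... | inj₁ y≡s = here (cong toℕ y≡s)
        ... | inj₂ l′  = there (subst (λ u → _ ∈ neighbours u) (same-predecessor l′ l) (complete (proj₁ (proj₂ l′))))

-- Powers of one third, and parity.

⅓ : ℚ
⅓ = ℤ.+ 1 ℚ./ 3

⅓^_ : ℕ → ℚ
⅓^ zero  = 1ℚ
⅓^ suc k = ⅓ * ⅓^ k

⅓^-triple : ∀ k → ⅓^ suc k + (⅓^ suc k + ⅓^ suc k) ≡ ⅓^ k
⅓^-triple k = solve 1 (λ x → con ⅓ :* x :+ (con ⅓ :* x :+ con ⅓ :* x) := x) refl (⅓^ k)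
  where open +-*-Solver

⅓^>0 : ∀ k → 0ℚ < ⅓^ k
⅓^>0 zero    = ℚ.positive⁻¹ 1ℚ
⅓^>0 (suc k) = subst (_< ⅓ * ⅓^ k) (ℚ.*-zeroʳ ⅓) (ℚ.*-monoʳ-<-pos ⅓ (⅓^>0 k))

⅓^-suc≤ : ∀ k → ⅓^ suc k ≤ ⅓^ k
⅓^-suc≤ k = ℚ.≤-trans (p≤p+q (ℚ.<⇒≤ (ℚ.+-mono-< (⅓^>0 (suc k)) (⅓^>0 (suc k))))) (ℚ.≤-reflexive (⅓^-triple k))

⅓^-antitone : ∀ {j k} → j ℕ.≤′ k → ⅓^ k ≤ ⅓^ j
⅓^-antitone ℕ.≤′-refl       = ℚ.≤-refl
⅓^-antitone (ℕ.≤′-step {k} j≤k) = ℚ.≤-trans (⅓^-suc≤ k) (⅓^-antitone j≤k)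

even-or-odd : ∀ k → k ≡ ℕ.⌊ k /2⌋ ℕ.+ ℕ.⌊ k /2⌋ ⊎ k ≡ suc (ℕ.⌊ k /2⌋ ℕ.+ ℕ.⌊ k /2⌋)
even-or-odd zero          = inj₁ refl
even-or-odd (suc zero)    = inj₂ refl
even-or-odd (suc (suc k)) with even-or-odd k
... | inj₁ eq = inj₁ (cong suc (trans (cong suc eq) (sym (ℕ.+-suc _ _))))
... | inj₂ eq = inj₂ (cong suc (trans (cong suc eq) (cong suc (sym (ℕ.+-suc _ _)))))

-- Binary trees: small skeleton dimension, large bandwidth.

module BinaryTree (m : ℕ) where

  parent<1+m : (k : Fin m) → ℕ.⌊ toℕ k /2⌋ ℕ.< suc m
  parent<1+m k = ℕ.s≤s (ℕ.≤-trans (ℕ.⌊n/2⌋≤n (toℕ k)) (ℕ.<⇒≤ (Fin.toℕ<n k)))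

  -- Nodes are numbered as in a binary heap: i has the children 2i+1 and 2i+2.
  parent : Fin m → Fin (suc m)
  parent k = Fin.fromℕ< (parent<1+m k)

  toℕ-parent : ∀ k → toℕ (parent k) ≡ ℕ.⌊ toℕ k /2⌋
  toℕ-parent k = Fin.toℕ-fromℕ< (parent<1+m k)

  parent≤ : ∀ k → toℕ (parent k) ℕ.≤ toℕ k
  parent≤ k = subst (ℕ._≤ toℕ k) (sym (toℕ-parent k)) (ℕ.⌊n/2⌋≤n (toℕ k))

  open Tree parent parent≤ (λ k → ⅓^ toℕ k) (λ k → ⅓^>0 (toℕ k)) public

  -- Lengths depend on the number of an edge instead of its depth. Numbers grow away from the root,
  -- so a child edge has the larger exponent.
  shrink : ∀ {k j} → parent k ≡ suc j → ⅓^ toℕ k + (⅓^ toℕ k + ⅓^ toℕ k) ≤ ⅓^ toℕ j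
  shrink {k} {j} eq with toℕ k | subst (ℕ._≤ toℕ k) (cong toℕ eq) (parent≤ k)
  ... | suc i | ℕ.s≤s j≤i = ℚ.≤-trans (ℚ.≤-reflexive (⅓^-triple i)) (⅓^-antitone (ℕ.≤⇒≤′ j≤i))

  open Contracting shrink

  -- The heap parent and the two heap children, as plain numbers: children beyond the last node may
  -- be listed, and the root lists itself as its parent.
  neighbours : Fin (suc m) → List ℕ
  neighbours u = ℕ.⌊ ℕ.pred (toℕ u) /2⌋ ∷ suc (toℕ u ℕ.+ toℕ u) ∷ suc (suc (toℕ u ℕ.+ toℕ u)) ∷ []

  neighbours-complete : ∀ {u v} → Link u v → toℕ v ∈ neighbours u
  neighbours-complete (up {k} refl) = here (toℕ-parent k)
  neighbours-complete (down {k} refl) rewrite toℕ-parent k with even-or-odd (toℕ k)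
  ... | inj₁ even = there (here (cong suc even))
  ... | inj₂ odd  = there (there (here (cong suc odd)))

  skeletonDimension≤4 : ∀ {κ} → IsSkeletonDimension tree κ → κ ℕ.≤ 4
  skeletonDimension≤4 ((s , r , _ , size) , _) =
    cut-bound tree size (cut-length neighbours (λ _ → ℕ.≤-refl) neighbours-complete)

  module _ (f : Permutation′ (suc m)) where

    gap : Fin (suc m) → Fin (suc m) → ℕ
    gap u v = ℕ.∣ toℕ (f ⟨$⟩ʳ u) - toℕ (f ⟨$⟩ʳ v) ∣

    gap-triangle : ∀ u v w → gap u w ℕ.≤ gap u v ℕ.+ gap v w
    gap-triangle u v w = ℕ.∣-∣-triangle (toℕ (f ⟨$⟩ʳ u)) (toℕ (f ⟨$⟩ʳ v)) (toℕ (f ⟨$⟩ʳ w))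

    -- The witness `h` is the depth of `v` in the heap. Each of the `h` edges up to the root changes
    -- the position by at most the stretch, and numbers at depth `h` start at `2 ^ h - 1`.
    gap-root : ∀ v → ∃[ h ] 2 ℕ.^ h ℕ.≤ suc (toℕ v) × gap v zero ℕ.≤ h ℕ.* stretch graph f
    gap-root v = go (suc (toℕ v)) v ℕ.≤-refl
      where
      go : ∀ fuel v → toℕ v ℕ.< fuel → ∃[ h ] 2 ℕ.^ h ℕ.≤ suc (toℕ v) × gap v zero ℕ.≤ h ℕ.* stretch graph f
      go _ zero _ = 0 , ℕ.≤-refl , ℕ.≤-reflexive (ℕ.∣n-n∣≡0 (toℕ (f ⟨$⟩ʳ zero)))
      go (suc fuel) (suc k) (ℕ.s≤s bound) with go fuel (parent k) (ℕ.<-≤-trans (parent< {k} refl) bound)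
      ... | h , 2^h≤ , gap≤ = suc h , power , ℕ.≤-trans (gap-triangle (suc k) (parent k) zero)
          (ℕ.+-mono-≤ (stretch-edge graph f (up {k} refl)) gap≤)
        where
        open ℕ.≤-Reasoning
        open Data.Nat.Solver.+-*-Solver
        i = ℕ.⌊ toℕ k /2⌋

        i+i≤k : i ℕ.+ i ℕ.≤ toℕ k
        i+i≤k with even-or-odd (toℕ k)
        ... | inj₁ even = ℕ.≤-reflexive (sym even)
        ... | inj₂ odd  = ℕ.≤-trans (ℕ.n≤1+n _) (ℕ.≤-reflexive (sym odd))

        power : 2 ℕ.^ suc h ℕ.≤ suc (suc (toℕ k))
        power = begin
          2 ℕ.* 2 ℕ.^ h            ≤⟨ ℕ.*-monoʳ-≤ 2 2^h≤ ⟩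
          2 ℕ.* suc (toℕ (parent k)) ≡⟨ cong (λ i → 2 ℕ.* suc i) (toℕ-parent k) ⟩
          2 ℕ.* suc i              ≡⟨ solve 1 (λ i → con 2 :* (con 1 :+ i) := con 2 :+ (i :+ i)) refl i ⟩
          2 ℕ.+ (i ℕ.+ i)          ≤⟨ ℕ.+-monoʳ-≤ 2 i+i≤k ⟩
          2 ℕ.+ toℕ k              ∎

    -- The nodes at the last and the first position are `m` positions apart, yet at most `H` edges
    -- lead from each of them to the root.
    m≤stretch : ∀ H → suc m ℕ.≤ 2 ℕ.^ H → m ℕ.≤ (H ℕ.+ H) ℕ.* stretch graph f
    m≤stretch H m<2^H = begin
      m                                             ≡⟨ Fin.toℕ-fromℕ m ⟨
      toℕ (Fin.fromℕ m)                             ≡⟨ cong toℕ (inverseʳ f) ⟨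
      toℕ (f ⟨$⟩ʳ top)                              ≡⟨ ℕ.∣-∣-identityʳ _ ⟨
      ℕ.∣ toℕ (f ⟨$⟩ʳ top) - 0 ∣                    ≡⟨ cong (λ i → ℕ.∣ toℕ (f ⟨$⟩ʳ top) - toℕ i ∣) (inverseʳ f) ⟨
      gap top bottom                                ≤⟨ gap-triangle top zero bottom ⟩
      gap top zero ℕ.+ gap zero bottom              ≡⟨ cong (gap top zero ℕ.+_) (ℕ.∣-∣-comm (toℕ (f ⟨$⟩ʳ zero)) (toℕ (f ⟨$⟩ʳ bottom))) ⟩
      gap top zero ℕ.+ gap bottom zero              ≤⟨ ℕ.+-mono-≤ (gap≤ top) (gap≤ bottom) ⟩
      H ℕ.* stretch graph f ℕ.+ H ℕ.* stretch graph f ≡⟨ ℕ.*-distribʳ-+ (stretch graph f) H H ⟨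
      (H ℕ.+ H) ℕ.* stretch graph f                 ∎
      where
      open ℕ.≤-Reasoning
      top    = f ⟨$⟩ˡ Fin.fromℕ m
      bottom = f ⟨$⟩ˡ zero

      gap≤ : ∀ v → gap v zero ℕ.≤ H ℕ.* stretch graph f
      gap≤ v with gap-root v
      ... | h , 2^h≤ , gap≤h = ℕ.≤-trans gap≤h (ℕ.*-monoˡ-≤ (stretch graph f) h≤H)
        where
        h≤H : h ℕ.≤ H
        h≤H = ℕ.≮⇒≥ λ H<h → ℕ.<⇒≱ (ℕ.^-monoʳ-< 2 (ℕ.s≤s (ℕ.s≤s ℕ.z≤n)) H<h)
          (ℕ.≤-trans 2^h≤ (ℕ.≤-trans (Fin.toℕ<n v) m<2^H))

-- Combs: bandwidth at most 2, large skeleton dimension.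

alternate : ∀ {A : Set} → A → A → ℕ → A
alternate x y zero    = x
alternate x y (suc k) = alternate y x k

alternate-even : ∀ {A : Set} (x y : A) i → alternate x y (i ℕ.+ i) ≡ x
alternate-even x y zero    = refl
alternate-even x y (suc i) rewrite ℕ.+-suc i i = alternate-even x y i

alternate-all : ∀ {A : Set} {P : A → Set} {x y} → P x → P y → ∀ k → P (alternate x y k)
alternate-all px py zero    = px
alternate-all {P = P} px py (suc k) = alternate-all {P = P} py px k

module Comb (N : ℕ) where

  m : ℕ
  m = N ℕ.+ N

  ⌊n/2⌋+⌊n/2⌋≤n : ∀ k → ℕ.⌊ k /2⌋ ℕ.+ ℕ.⌊ k /2⌋ ℕ.≤ k
  ⌊n/2⌋+⌊n/2⌋≤n k = ℕ.≤-trans (ℕ.+-monoʳ-≤ ℕ.⌊ k /2⌋ (ℕ.⌊n/2⌋≤⌈n/2⌉ k)) (ℕ.≤-reflexive (ℕ.⌊n/2⌋+⌈n/2⌉≡n k))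

  parent<1+m : (k : Fin m) → ℕ.⌊ toℕ k /2⌋ ℕ.+ ℕ.⌊ toℕ k /2⌋ ℕ.< suc m
  parent<1+m k = ℕ.s≤s (ℕ.≤-trans (⌊n/2⌋+⌊n/2⌋≤n (toℕ k)) (ℕ.<⇒≤ (Fin.toℕ<n k)))

  -- The even nodes form the spine; the odd node 2i+1 is the leaf attached to 2i.
  parent : Fin m → Fin (suc m)
  parent k = Fin.fromℕ< (parent<1+m k)

  toℕ-parent : ∀ k → toℕ (parent k) ≡ ℕ.⌊ toℕ k /2⌋ ℕ.+ ℕ.⌊ toℕ k /2⌋
  toℕ-parent k = Fin.toℕ-fromℕ< (parent<1+m k)

  parent≤ : ∀ k → toℕ (parent k) ℕ.≤ toℕ k
  parent≤ k = subst (ℕ._≤ toℕ k) (sym (toℕ-parent k)) (⌊n/2⌋+⌊n/2⌋≤n (toℕ k))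

  2ℚ : ℚ
  2ℚ = 1ℚ + 1ℚ

  -- Even `k` are the legs. Odd `k` are the spine edges, whose lengths have a sum below 1.
  len : Fin m → ℚ
  len k = alternate 2ℚ (⅓^ toℕ k) (toℕ k)

  len>0 : ∀ k → 0ℚ < len k
  len>0 k = alternate-all {P = 0ℚ <_} (ℚ.positive⁻¹ 2ℚ) (⅓^>0 (toℕ k)) (toℕ k)

  open Tree parent parent≤ len len>0 public
  open WeightedGraph tree using (dist; shortest)

  -- The numbering of the nodes is itself a good layout: a leg joins `2i` to `2i+1`, and a spine
  -- edge joins `2i` to `2i+2`.
  bandwidth≤2 : ∀ {b} → Bandwidth tree b → b ℕ.≤ 2
  bandwidth≤2 (_ , least) = ℕ.≤-trans (least _ (id , refl)) (stretch-bound graph id 2 edge≤2)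
    where
    gap : ∀ k → ℕ.∣ suc (toℕ k) - toℕ (parent k) ∣ ℕ.≤ 2
    gap k rewrite ℕ.m≤n⇒∣n-m∣≡n∸m (ℕ.m≤n⇒m≤1+n (parent≤ k)) | toℕ-parent k with even-or-odd (toℕ k)
    ... | inj₁ even = ℕ.m≤n+o⇒m∸n≤o _ _ (subst (suc (toℕ k) ℕ.≤_) (ℕ.+-comm 2 _) (ℕ.s≤s (ℕ.≤-trans (ℕ.≤-reflexive even) (ℕ.n≤1+n _))))
    ... | inj₂ odd  = ℕ.m≤n+o⇒m∸n≤o _ _ (subst (suc (toℕ k) ℕ.≤_) (ℕ.+-comm 2 _) (ℕ.s≤s (ℕ.≤-reflexive odd)))

    edge≤2 : ∀ {u v} → Link u v → ℕ.∣ toℕ u - toℕ v ∣ ℕ.≤ 2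
    edge≤2 (up {k} refl)   = gap k
    edge≤2 (down {k} refl) = subst (ℕ._≤ 2) (ℕ.∣-∣-comm (suc (toℕ k)) (toℕ (parent k))) (gap k)

  -- The added power is the slack that carries the induction: it pays for the next spine edge
  -- together with the slack after it. Being positive, it also makes the distance strictly less than
  -- 1.
  spine-dist : ∀ i v → toℕ v ≡ i ℕ.+ i → dist zero v + ⅓^ toℕ v ≤ 1ℚ
  spine-dist zero    zero    _  = ℚ.≤-reflexive (cong (_+ 1ℚ) (cong (WeightedGraph.weight tree) (shortest-self tree zero)))
  spine-dist (suc i) (suc k) eq = begin
    dist zero (suc k) + ⅓^ suc (toℕ k)
      ≡⟨ cong (_+ ⅓^ suc (toℕ k)) (dist-treeEdge tree (down refl) (descending-from-root k)) ⟩
    dist zero (parent k) + len k + ⅓^ suc (toℕ k)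
      ≡⟨ ℚ.+-assoc (dist zero (parent k)) (len k) (⅓^ suc (toℕ k)) ⟩
    dist zero (parent k) + (len k + ⅓^ suc (toℕ k))
      ≤⟨ ℚ.+-monoʳ-≤ (dist zero (parent k)) spine-step ⟩
    dist zero (parent k) + ⅓^ toℕ (parent k)
      ≤⟨ spine-dist i (parent k) parent-even ⟩
    1ℚ ∎
    where
    open ℚ.≤-Reasoning

    k-odd : toℕ k ≡ suc (i ℕ.+ i)
    k-odd = ℕ.suc-injective (trans eq (cong suc (ℕ.+-suc i i)))

    parent-even : toℕ (parent k) ≡ i ℕ.+ i
    parent-even = trans (toℕ-parent k) (cong (λ j → j ℕ.+ j) (trans (cong ℕ.⌊_/2⌋ k-odd) (half i)))
      where
      half : ∀ i → ℕ.⌊ suc (i ℕ.+ i) /2⌋ ≡ i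
      half zero    = refl
      half (suc i) rewrite ℕ.+-suc i i = cong suc (half i)

    spine-step : len k + ⅓^ suc (toℕ k) ≤ ⅓^ toℕ (parent k)
    spine-step rewrite parent-even | k-odd | alternate-even (⅓^ suc (i ℕ.+ i)) 2ℚ i = begin
      x + ⅓^ suc (suc (i ℕ.+ i))  ≤⟨ ℚ.+-monoʳ-≤ x (ℚ.≤-trans (⅓^-suc≤ (suc (i ℕ.+ i))) (p≤p+q (ℚ.<⇒≤ (⅓^>0 (suc (i ℕ.+ i)))))) ⟩
      x + (x + x)                 ≡⟨ ⅓^-triple (i ℕ.+ i) ⟩
      ⅓^ (i ℕ.+ i)                ∎
      where x = ⅓^ suc (i ℕ.+ i)

  leg : Fin N → Fin m
  leg i = Fin.fromℕ< (ℕ.+-mono-< (Fin.toℕ<n i) (Fin.toℕ<n i))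

  toℕ-leg : ∀ i → toℕ (leg i) ≡ toℕ i ℕ.+ toℕ i
  toℕ-leg i = Fin.toℕ-fromℕ< (ℕ.+-mono-< (Fin.toℕ<n i) (Fin.toℕ<n i))

  -- Chosen to put the point on the leg at depth exactly 1.
  offset : Fin N → ℚ
  offset i = 1ℚ - dist zero (parent (leg i))

  leg-point : Fin N → Point tree
  leg-point i = inside (down {leg i} refl) (offset i)

  leg-point-injective : ∀ {i j} → leg-point i ≡ leg-point j → i ≡ j
  leg-point-injective {i} {j} eq = Fin.toℕ-injective (begin
    toℕ i                          ≡⟨ ℕ.n≡⌊n+n/2⌋ (toℕ i) ⟩
    ℕ.⌊ toℕ i ℕ.+ toℕ i /2⌋        ≡⟨ cong ℕ.⌊_/2⌋ (toℕ-leg i) ⟨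
    -- The far end of `leg-point i` is the leaf numbered `2i+1`, from which `i` is recovered.
    ℕ.⌊ toℕ (leg i) /2⌋            ≡⟨ cong (λ x → ℕ.⌊ ℕ.pred (toℕ (far tree x)) /2⌋) eq ⟩
    ℕ.⌊ toℕ (leg j) /2⌋            ≡⟨ cong ℕ.⌊_/2⌋ (toℕ-leg j) ⟩
    ℕ.⌊ toℕ j ℕ.+ toℕ j /2⌋        ≡⟨ ℕ.n≡⌊n+n/2⌋ (toℕ j) ⟨
    toℕ j                          ∎)
    where open ≡-Reasoning

  leg-point-cut : ∀ i → Cut tree zero 1ℚ (leg-point i)
  leg-point-cut i =
    ( inside (descending-from-root (leg i)) offset>0 offset<len
    , node (suc (leg i)) , _ , node (suc (leg i))
    , inside-node (node-node ε (sym (◅◅-identityʳ (shortest zero (suc (leg i))))))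
    , long)
    , depth≡1
    where
    open ℚ.≤-Reasoning
    open +-*-Solver
    D = dist zero (parent (leg i))

    depth≡1 : D + offset i ≡ 1ℚ
    depth≡1 = solve 1 (λ d → d :+ (con 1ℚ :- d) := con 1ℚ) refl D

    parent-leg : toℕ (parent (leg i)) ≡ toℕ i ℕ.+ toℕ i
    parent-leg = trans (toℕ-parent (leg i)) (cong (λ j → j ℕ.+ j)
      (trans (cong ℕ.⌊_/2⌋ (toℕ-leg i)) (sym (ℕ.n≡⌊n+n/2⌋ (toℕ i)))))

    len-leg : len (leg i) ≡ 2ℚ
    len-leg = trans (cong (alternate 2ℚ _) (toℕ-leg i)) (alternate-even 2ℚ _ (toℕ i))

    offset>0 : 0ℚ < offset i
    offset>0 = subst (_< offset i) (ℚ.+-inverseʳ D) (ℚ.+-monoˡ-< (ℚ.- D)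
      (ℚ.<-≤-trans (p<p+q {D} (⅓^>0 (toℕ (parent (leg i))))) (spine-dist (toℕ i) (parent (leg i)) parent-leg)))

    offset≤1 : offset i ≤ 1ℚ
    offset≤1 = begin
      offset i     ≡⟨ ℚ.+-identityˡ (offset i) ⟨
      0ℚ + offset i ≤⟨ ℚ.+-monoˡ-≤ (offset i) (dist≥0 tree zero (parent (leg i))) ⟩
      D + offset i ≡⟨ depth≡1 ⟩
      1ℚ           ∎

    offset<len : offset i < len (leg i)
    offset<len = subst (offset i <_) (sym len-leg) (ℚ.≤-<-trans offset≤1 (p<p+q (ℚ.positive⁻¹ 1ℚ)))

    -- The leaf at the end of the leg is the witness: the offset is at most 1, so at least 1 of the
    -- length 2 remains, and half of the depth 1 suffices.
    long : ½ * (D + offset i) ≤ (len (leg i) - offset i) + 0ℚ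
    long = begin
      ½ * (D + offset i)           ≡⟨ cong (½ *_) depth≡1 ⟩
      ½ * 1ℚ                       ≤⟨ p≤p+q (ℚ.nonNegative⁻¹ ½) ⟩
      1ℚ                           ≡⟨⟩
      2ℚ - 1ℚ                      ≤⟨ ℚ.+-monoʳ-≤ 2ℚ (ℚ.neg-antimono-≤ offset≤1) ⟩
      2ℚ - offset i                ≡⟨ cong (_- offset i) len-leg ⟨
      len (leg i) - offset i       ≡⟨ ℚ.+-identityʳ (len (leg i) - offset i) ⟨
      (len (leg i) - offset i) + 0ℚ ∎

  ¬¬-skeletonDimension≥N : ¬ ¬ (∃[ κ ] IsSkeletonDimension tree κ × N ℕ.≤ κ)
  ¬¬-skeletonDimension≥N = subst (λ k → ¬ ¬ (∃[ κ ] IsSkeletonDimension tree κ × k ℕ.≤ κ)) (length-tabulate leg-point)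
    (¬¬-skeletonDimension tree (ℚ.nonNegative⁻¹ 1ℚ) (Unique.tabulate⁺ leg-point-injective) (All.tabulate⁺ leg-point-cut))

-- The two separations.

n<2^n : ∀ n → n ℕ.< 2 ℕ.^ n
n<2^n zero    = ℕ.s≤s ℕ.z≤n
n<2^n (suc n) = ℕ.+-mono-≤ (ℕ.m^n>0 2 n) (ℕ.≤-trans (n<2^n n) (ℕ.m≤m+n (2 ℕ.^ n) 0))

-- The bounding function may fail to be monotone, so a bound on its argument is turned into a bound
-- on its value by adding up all values up to `B`.
bounded-on-≤ : ∀ (f : ℕ → ℕ) B → ∃[ M ] ∀ {b} → b ℕ.≤ B → f b ℕ.≤ M
bounded-on-≤ f zero = f 0 , λ { ℕ.z≤n → ℕ.≤-refl }
bounded-on-≤ f (suc B) with bounded-on-≤ f B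
... | M , bound = M ℕ.+ f (suc B) , λ b≤ → case ℕ.m≤n⇒m<n∨m≡n b≤ of λ
  { (inj₁ (ℕ.s≤s b≤B)) → ℕ.≤-trans (bound b≤B) (ℕ.m≤m+n M _)
  ; (inj₂ refl)        → ℕ.m≤n+m _ M }

theorem19 : Incomparable IsMetric IsSkeletonDimension Bandwidth
theorem19 = skeletonDimension-unbounded , bandwidth-unbounded
  where
  skeletonDimension-unbounded : ¬ BoundedBy IsMetric IsSkeletonDimension Bandwidth
  skeletonDimension-unbounded (f , bound) with bounded-on-≤ f 2
  ... | M , f≤M = ¬¬-skeletonDimension≥N λ (κ , isκ , M<κ) → ¬¬-bandwidth tree λ (b , isb) →
      ℕ.<⇒≱ M<κ (ℕ.≤-trans (bound tree tree-metric isκ isb) (f≤M (bandwidth≤2 isb)))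
    -- One leg more than the bound `M` on the skeleton dimension.
    where open Comb (suc M)

  bandwidth-unbounded : ¬ BoundedBy IsMetric Bandwidth IsSkeletonDimension
  bandwidth-unbounded (f , bound) with bounded-on-≤ f 4
  -- The empty list is part of every cut, so the cut at radius 0 around the root provides a value of
  -- the skeleton dimension.
  ... | M , f≤M = ¬¬-skeletonDimension tree {s = zero} ℚ.≤-refl [] [] λ (κ , isκ , _) →
      ¬¬-bandwidth tree λ { (b , isb@((σ , refl) , _)) →
      contra σ (ℕ.≤-trans (bound tree tree-metric isb isκ) (f≤M (skeletonDimension≤4 isκ))) }
    where
    -- With this `m`, `suc m` is the square of `suc k`, hence at most `2 ^ (k + k)`, and `k + k` can
    -- serve as `H`. The choice of `k` makes `4 * M` less than `k`, so that `m`, which is at least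
    -- the square of `k`, exceeds `4 * k * M`.
    k m : ℕ
    k = suc (4 ℕ.* M)
    m = k ℕ.+ k ℕ.* suc k
    open BinaryTree m

    1+m≤4^k : suc m ℕ.≤ 2 ℕ.^ (k ℕ.+ k)
    1+m≤4^k = subst (suc m ℕ.≤_) (sym (ℕ.^-distribˡ-+-* 2 k k)) (ℕ.*-mono-≤ (n<2^n k) (n<2^n k))

    regroup : ∀ k M → ((k ℕ.+ k) ℕ.+ (k ℕ.+ k)) ℕ.* M ≡ k ℕ.* (4 ℕ.* M)
    regroup = solve 2 (λ k M → ((k :+ k) :+ (k :+ k)) :* M := k :* (con 4 :* M)) refl
      where open Data.Nat.Solver.+-*-Solver

    contra : ∀ σ → stretch graph σ ℕ.≤ M → ⊥
    contra σ σ≤M = ℕ.<-irrefl refl (begin-strict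
      m                                              ≤⟨ m≤stretch σ (k ℕ.+ k) 1+m≤4^k ⟩
      ((k ℕ.+ k) ℕ.+ (k ℕ.+ k)) ℕ.* stretch graph σ  ≤⟨ ℕ.*-monoʳ-≤ ((k ℕ.+ k) ℕ.+ (k ℕ.+ k)) σ≤M ⟩
      ((k ℕ.+ k) ℕ.+ (k ℕ.+ k)) ℕ.* M                ≡⟨ regroup k M ⟩
      k ℕ.* (4 ℕ.* M)                                <⟨ ℕ.*-monoʳ-< k ℕ.≤-refl ⟩
      k ℕ.* k                                        ≤⟨ ℕ.*-monoʳ-≤ k (ℕ.n≤1+n k) ⟩
      k ℕ.* suc k                                    ≤⟨ ℕ.m≤n+m _ k ⟩
      m                                              ∎)
      where open ℕ.≤-Reasoning
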